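{- For every integer $n>2$, the length of the $n$-th segment of the golden spiral equals the length of the $(n-2)$-th segment minus the length of the $(n-1)$-th segment.
   Context: $\phi=\frac{1+\sqrt5}{2}$. The golden spiral is split into segments indexed by integers $n\ge1$, where, by definition, the $n$-th segment has length $\frac{1}{\phi^{n-1}}$. -}

module Defs where

open import Data.Integer.Base as ℤ using (+_; -[1+_])
import Data.Integer.Properties as ℤ
open import Data.Nat.Base as ℕ using (ℕ; zero; suc; z≤n; s≤s)
import Data.Nat.Properties as ℕ
open import Data.Product.Base using (∃; _×_; _,_)
open import Data.Rational.Base as ℚ
  using (ℚ; mkℚ; 0ℚ; 1ℚ; ½; _<_; _≤_; _+_; _-_; _*_; -_; ∣_∣; 1/_; Positive; positive)
open import Data.Rational.Properties
open import Data.Rational.Solver using (module +-*-Solver)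
import Data.Rational.Unnormalised.Base as ℚᵘ
import Data.Rational.Unnormalised.Properties as ℚᵘ
open import Data.Sum.Base using (inj₁; inj₂)
open import Relation.Binary.PropositionalEquality
  using (_≡_; _≢_; refl; sym; trans; cong; cong₂; subst₂)
open import Relation.Nullary using (yes; no; contradiction)
open import Relation.Nullary.Decidable using (toWitness)

open +-*-Solver using (solve; _:=_; _:+_; _:*_; _:-_; :-_; con)

abstract
  0<1 : 0ℚ < 1ℚ
  0<1 = toWitness {a? = 0ℚ <? 1ℚ} _

  0<½ : 0ℚ < ½
  0<½ = toWitness {a? = 0ℚ <? ½} _

  p≤p+q : ∀ {p q} → 0ℚ ≤ q → p ≤ p + q
  p≤p+q {p} 0≤q = ≤-trans (≤-reflexive (sym (+-identityʳ p))) (+-monoʳ-≤ p 0≤q)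

  p<p+q : ∀ {p q} → 0ℚ < q → p < p + q
  p<p+q {p} 0<q = ≤-<-trans (≤-reflexive (sym (+-identityʳ p))) (+-monoʳ-< p 0<q)

  0<p*q : ∀ {p q} → 0ℚ < p → 0ℚ < q → 0ℚ < p * q
  0<p*q {p} {q} 0<p 0<q =
    positive⁻¹ (p * q) {{pos*pos⇒pos p {{positive 0<p}} q {{positive 0<q}}}}

  *-mono-≤ : ∀ {p q r s} → 0ℚ ≤ p → 0ℚ ≤ s → p ≤ q → r ≤ s → p * r ≤ q * s
  *-mono-≤ {p} {q} {r} {s} 0≤p 0≤s p≤q r≤s = ≤-trans
    (*-monoˡ-≤-nonNeg p {{ℚ.nonNegative 0≤p}} r≤s)
    (*-monoʳ-≤-nonNeg s {{ℚ.nonNegative 0≤s}} p≤q)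

  p<q+r⇒p-q<r : ∀ {p q r} → p < q + r → p - q < r
  p<q+r⇒p-q<r {p} {q} {r} p<q+r = <-≤-trans (+-monoˡ-< (- q) p<q+r)
    (≤-reflexive (solve 2 (λ q r → (q :+ r) :- q := r) refl q r))

  -[p-q]≡q-p : ∀ p q → - (p - q) ≡ q - p
  -[p-q]≡q-p p q = solve 2 (λ p q → :- (p :- q) := q :- p) refl p q

  ∣p∣<q : ∀ {p q} → p < q → - p < q → ∣ p ∣ < q
  ∣p∣<q {p} p<q -p<q with ∣p∣≡p∨∣p∣≡-p p
  ... | inj₁ eq = ≤-<-trans (≤-reflexive eq) p<q
  ... | inj₂ eq = ≤-<-trans (≤-reflexive eq) -p<q

  divide : ∀ b → 0ℚ < b → ∀ ε → 0ℚ < ε → ∃ λ δ → 0ℚ < δ × b * δ ≡ ε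
  divide b 0<b ε 0<ε = ε * b⁻¹ , 0<p*q 0<ε (positive⁻¹ b⁻¹ {{1/pos⇒pos b {{positive 0<b}}}}) ,
    trans (solve 3 (λ b ε c → b :* (ε :* c) := ε :* (b :* c)) refl b ε b⁻¹)
      (trans (cong (ε *_) (*-inverseʳ b {{b≢0}})) (*-identityʳ ε))
    where
    b≢0 : ℚ.NonZero b
    b≢0 = pos⇒nonZero b {{positive 0<b}}
    b⁻¹ : ℚ
    b⁻¹ = (1/ b) {{b≢0}}

-- The multiplicative inverse, with the value 0 at 0.
recip : ℚ → ℚ
recip p with p ≟ 0ℚ
... | yes _   = 0ℚ
... | no  p≢0 = (1/ p) {{ℚ.≢-nonZero p≢0}}

abstract
  recip-inverse : ∀ {p} → p ≢ 0ℚ → p * recip p ≡ 1ℚ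
  recip-inverse {p} p≢0 with p ≟ 0ℚ
  ... | yes p≡0  = contradiction p≡0 p≢0
  ... | no  p≢0′ = *-inverseʳ p {{ℚ.≢-nonZero p≢0′}}

  sum-error : ∀ a b c d {δ} → ∣ a - c ∣ < δ → ∣ b - d ∣ < δ →
    ∣ (a + b) - (c + d) ∣ < (1ℚ + 1ℚ) * δ
  sum-error a b c d {δ} Δ₁ Δ₂ = let open ≤-Reasoning in begin-strict
    ∣ (a + b) - (c + d) ∣
      ≡⟨ cong ∣_∣ (solve 4 (λ a b c d → (a :+ b) :- (c :+ d) := (a :- c) :+ (b :- d))
           refl a b c d) ⟩
    ∣ (a - c) + (b - d) ∣    ≤⟨ ∣p+q∣≤∣p∣+∣q∣ (a - c) (b - d) ⟩
    ∣ a - c ∣ + ∣ b - d ∣    <⟨ +-mono-< Δ₁ Δ₂ ⟩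
    δ + δ                    ≡⟨ solve 1 (λ d → d :+ d := (con 1ℚ :+ con 1ℚ) :* d) refl δ ⟩
    (1ℚ + 1ℚ) * δ            ∎

  product-error : ∀ x y x′ y′ {b c δ} → 0ℚ < b → 0ℚ < c → ∣ x ∣ ≤ b → ∣ y′ ∣ ≤ c →
    ∣ x - x′ ∣ < δ → ∣ y - y′ ∣ < δ → ∣ x * y - x′ * y′ ∣ < (b + c) * δ
  product-error x y x′ y′ {b} {c} {δ} 0<b 0<c ∣x∣≤b ∣y′∣≤c Δx Δy =
    let open ≤-Reasoning in begin-strict
    ∣ x * y - x′ * y′ ∣
      ≡⟨ cong ∣_∣ (solve 4 (λ a b c d → (a :* b) :- (c :* d)
           := (a :* (b :- d)) :+ (d :* (a :- c))) refl x y x′ y′) ⟩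
    ∣ x * (y - y′) + y′ * (x - x′) ∣
      ≤⟨ ∣p+q∣≤∣p∣+∣q∣ (x * (y - y′)) (y′ * (x - x′)) ⟩
    ∣ x * (y - y′) ∣ + ∣ y′ * (x - x′) ∣
      ≡⟨ cong₂ _+_ (∣p*q∣≡∣p∣*∣q∣ x (y - y′)) (∣p*q∣≡∣p∣*∣q∣ y′ (x - x′)) ⟩
    ∣ x ∣ * ∣ y - y′ ∣ + ∣ y′ ∣ * ∣ x - x′ ∣
      ≤⟨ +-mono-≤ (*-mono-≤ (0≤∣p∣ x) (0≤∣p∣ (y - y′)) ∣x∣≤b ≤-refl)
                  (*-mono-≤ (0≤∣p∣ y′) (0≤∣p∣ (x - x′)) ∣y′∣≤c ≤-refl) ⟩
    b * ∣ y - y′ ∣ + c * ∣ x - x′ ∣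
      <⟨ +-mono-< (*-monoʳ-<-pos b {{positive 0<b}} Δy)
                  (*-monoʳ-<-pos c {{positive 0<c}} Δx) ⟩
    b * δ + c * δ   ≡⟨ *-distribʳ-+ δ b c ⟨
    (b + c) * δ     ∎

  0<g≤∣p∣⇒p≢0 : ∀ {g p} → 0ℚ < g → g ≤ ∣ p ∣ → p ≢ 0ℚ
  0<g≤∣p∣⇒p≢0 0<g g≤∣p∣ refl = <-irrefl refl (<-≤-trans 0<g g≤∣p∣)

  recip-error : ∀ a b {g ε} → 0ℚ < g → g ≤ ∣ a ∣ → g ≤ ∣ b ∣ →
    ∣ b - a ∣ < ε * (g * g) → ∣ recip a - recip b ∣ < ε
  recip-error a b {g} {ε} 0<g g≤∣a∣ g≤∣b∣ Δ =
    go (recip a) (recip b) (recip-inverse (0<g≤∣p∣⇒p≢0 0<g g≤∣a∣))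
                           (recip-inverse (0<g≤∣p∣⇒p≢0 0<g g≤∣b∣))
    where
    clear : ∀ c d → a * c ≡ 1ℚ → b * d ≡ 1ℚ → (c - d) * (a * b) ≡ b - a
    clear c d ac≡1 bd≡1 = trans
      (solve 4 (λ a b c d → (c :- d) :* (a :* b) := b :* (a :* c) :- a :* (b :* d))
        refl a b c d)
      (cong₂ _-_ (trans (cong (b *_) ac≡1) (*-identityʳ b))
                 (trans (cong (a *_) bd≡1) (*-identityʳ a)))
    go : ∀ c d → a * c ≡ 1ℚ → b * d ≡ 1ℚ → ∣ c - d ∣ < ε
    go c d ac≡1 bd≡1 = let open ≤-Reasoning in
      *-cancelʳ-<-nonNeg (g * g) {{ℚ.nonNegative (<⇒≤ (0<p*q 0<g 0<g))}} (begin-strict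
        ∣ c - d ∣ * (g * g)
          ≤⟨ *-monoˡ-≤-nonNeg ∣ c - d ∣ {{∣-∣-nonNeg (c - d)}}
               (*-mono-≤ (<⇒≤ 0<g) (0≤∣p∣ b) g≤∣a∣ g≤∣b∣) ⟩
        ∣ c - d ∣ * (∣ a ∣ * ∣ b ∣)   ≡⟨ cong (∣ c - d ∣ *_) (∣p*q∣≡∣p∣*∣q∣ a b) ⟨
        ∣ c - d ∣ * ∣ a * b ∣         ≡⟨ ∣p*q∣≡∣p∣*∣q∣ (c - d) (a * b) ⟨
        ∣ (c - d) * (a * b) ∣         ≡⟨ cong ∣_∣ (clear c d ac≡1 bd≡1) ⟩
        ∣ b - a ∣                     <⟨ Δ ⟩
        ε * (g * g)                   ∎)

  ∣p∣≤∣p-q∣+∣q∣ : ∀ p q → ∣ p ∣ ≤ ∣ p - q ∣ + ∣ q ∣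
  ∣p∣≤∣p-q∣+∣q∣ p q = ≤-trans
    (≤-reflexive (cong ∣_∣ (solve 2 (λ a b → a := (a :- b) :+ b) refl p q)))
    (∣p+q∣≤∣p∣+∣q∣ (p - q) q)

  neg-error : ∀ p q → ∣ - p - - q ∣ ≡ ∣ p - q ∣
  neg-error p q = trans
    (cong ∣_∣ (solve 2 (λ a b → (:- a) :- (:- b) := :- (a :- b)) refl p q))
    (∣-p∣≡∣p∣ (p - q))

fromℕ : ℕ → ℚ
fromℕ zero    = 0ℚ
fromℕ (suc n) = 1ℚ + fromℕ n

abstract
  fromℕ-nonNeg : ∀ n → 0ℚ ≤ fromℕ n
  fromℕ-nonNeg zero    = ≤-refl
  fromℕ-nonNeg (suc n) = ≤-trans (<⇒≤ 0<1) (p≤p+q (fromℕ-nonNeg n))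

  archimedean : ∀ p → ∃ λ n → p ≤ fromℕ n
  archimedean p = ℤ.∣ ℚ.numerator p ∣ , toℚᵘ-cancel-≤ (bound p)
    where
    toℚᵘ-fromℕ : ∀ n → ℚ.toℚᵘ (fromℕ n) ℚᵘ.≃ ℚᵘ.mkℚᵘ (+ n) 0
    toℚᵘ-fromℕ zero    = ℚᵘ.*≡* refl
    toℚᵘ-fromℕ (suc n) = ℚᵘ.≃-trans (toℚᵘ-homo-+ 1ℚ (fromℕ n))
      (ℚᵘ.≃-trans (ℚᵘ.+-congʳ (ℚ.toℚᵘ 1ℚ) (toℚᵘ-fromℕ n))
        (ℚᵘ.*≡* (cong (ℤ._* + 1) (cong (λ k → + 1 ℤ.+ k) (ℤ.*-identityʳ (+ n))))))
    bound : ∀ p → ℚ.toℚᵘ p ℚᵘ.≤ ℚ.toℚᵘ (fromℕ ℤ.∣ ℚ.numerator p ∣)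
    bound (mkℚ (+ a) d _) = ℚᵘ.≤-trans
      (ℚᵘ.*≤* (ℤ.*-monoˡ-≤-nonNeg (+ a) (ℤ.+≤+ (s≤s z≤n))))
      (ℚᵘ.≤-reflexive (ℚᵘ.≃-sym (toℚᵘ-fromℕ a)))
    bound (mkℚ -[1+ a ] d _) = ℚᵘ.≤-trans
      (ℚᵘ.*≤* (subst₂ ℤ._≤_ (sym (ℤ.*-identityʳ -[1+ a ])) refl ℤ.-≤+))
      (ℚᵘ.≤-reflexive (ℚᵘ.≃-sym (toℚᵘ-fromℕ (suc a))))

-- Real numbers: Cauchy sequences of rationals, taken up to _≃_

IsCauchy : (ℕ → ℚ) → Set
IsCauchy x = ∀ ε → 0ℚ < ε →
  ∃ λ N → ∀ m n → N ℕ.≤ m → N ℕ.≤ n → ∣ x m - x n ∣ < ε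

record ℝ : Set where
  constructor mkℝ
  field
    seq      : ℕ → ℚ
    isCauchy : IsCauchy seq

open ℝ public

infix 4 _≃_

record _≃_ (x y : ℝ) : Set where
  constructor mk≃
  field
    converge : ∀ ε → 0ℚ < ε →
      ∃ λ N → ∀ n → N ℕ.≤ n → ∣ seq x n - seq y n ∣ < ε

-- Apartness from zero: |x| is eventually bounded below by a positive rational.
record NonZeroℝ (x : ℝ) : Set where
  constructor mkNonZeroℝ
  field
    gap     : ℚ
    0<gap   : 0ℚ < gap
    from    : ℕ
    bounded : ∀ n → from ℕ.≤ n → gap ≤ ∣ seq x n ∣

fromℚ : ℚ → ℝ
fromℚ p = mkℝ (λ _ → p) λ ε 0<ε →
  0 , λ _ _ _ _ → ≤-<-trans (≤-reflexive (cong ∣_∣ (+-inverseʳ p))) 0<ε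

infixl 6 _+ℝ_ _-ℝ_
infixl 7 _*ℝ_
infix  8 -ℝ_
infixr 8 _^ℝ_

_+ℝ_ : ℝ → ℝ → ℝ
x +ℝ y = mkℝ (λ n → seq x n + seq y n) cauchy
  where
  abstract
    cauchy : IsCauchy (λ n → seq x n + seq y n)
    cauchy ε 0<ε =
      let δ , 0<δ , 2δ≡ε = divide (1ℚ + 1ℚ) (<-trans 0<1 (p<p+q 0<1)) ε 0<ε
          M , xM = isCauchy x δ 0<δ
          N , yN = isCauchy y δ 0<δ
      in M ℕ.⊔ N , λ m n K≤m K≤n → <-≤-trans
        (sum-error (seq x m) (seq y m) (seq x n) (seq y n)
          (xM m n (ℕ.m⊔n≤o⇒m≤o M N K≤m) (ℕ.m⊔n≤o⇒m≤o M N K≤n))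
          (yN m n (ℕ.m⊔n≤o⇒n≤o M N K≤m) (ℕ.m⊔n≤o⇒n≤o M N K≤n)))
        (≤-reflexive 2δ≡ε)

-ℝ_ : ℝ → ℝ
-ℝ x = mkℝ (λ n → - seq x n) λ ε 0<ε → let N , xN = isCauchy x ε 0<ε in
  N , λ m n N≤m N≤n →
    ≤-<-trans (≤-reflexive (neg-error (seq x m) (seq x n))) (xN m n N≤m N≤n)

_-ℝ_ : ℝ → ℝ → ℝ
x -ℝ y = x +ℝ (-ℝ y)

abstract
  eventuallyBounded : ∀ x → ∃ λ b → 0ℚ < b × ∃ λ N → ∀ n → N ℕ.≤ n → ∣ seq x n ∣ ≤ b
  eventuallyBounded x = let N , xN = isCauchy x 1ℚ 0<1 in
    1ℚ + ∣ seq x N ∣ , <-≤-trans 0<1 (p≤p+q (0≤∣p∣ (seq x N))) , N , λ n N≤n →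
    ≤-trans (∣p∣≤∣p-q∣+∣q∣ (seq x n) (seq x N))
      (+-monoˡ-≤ ∣ seq x N ∣ (<⇒≤ (xN n N N≤n ℕ.≤-refl)))

_*ℝ_ : ℝ → ℝ → ℝ
x *ℝ y = mkℝ (λ n → seq x n * seq y n) cauchy
  where
  abstract
    cauchy : IsCauchy (λ n → seq x n * seq y n)
    cauchy ε 0<ε =
      let b , 0<b , B , x≤b = eventuallyBounded x
          c , 0<c , C , y≤c = eventuallyBounded y
          δ , 0<δ , [b+c]δ≡ε = divide (b + c) (<-trans 0<b (p<p+q 0<c)) ε 0<ε
          M , xM = isCauchy x δ 0<δ
          N , yN = isCauchy y δ 0<δ
      in (B ℕ.⊔ C) ℕ.⊔ (M ℕ.⊔ N) , close 0<b 0<c [b+c]δ≡ε B x≤b C y≤c M xM N yN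
      where
      close : ∀ {b c δ ε} → 0ℚ < b → 0ℚ < c → (b + c) * δ ≡ ε →
        ∀ B → (∀ n → B ℕ.≤ n → ∣ seq x n ∣ ≤ b) →
        ∀ C → (∀ n → C ℕ.≤ n → ∣ seq y n ∣ ≤ c) →
        ∀ M → (∀ m n → M ℕ.≤ m → M ℕ.≤ n → ∣ seq x m - seq x n ∣ < δ) →
        ∀ N → (∀ m n → N ℕ.≤ m → N ℕ.≤ n → ∣ seq y m - seq y n ∣ < δ) →
        ∀ m n → (B ℕ.⊔ C) ℕ.⊔ (M ℕ.⊔ N) ℕ.≤ m → (B ℕ.⊔ C) ℕ.⊔ (M ℕ.⊔ N) ℕ.≤ n →
        ∣ seq x m * seq y m - seq x n * seq y n ∣ < ε
      close {b} {c} {δ} 0<b 0<c refl B x≤b C y≤c M xM N yN m n K≤m K≤n =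
        product-error (seq x m) (seq y m) (seq x n) (seq y n) {b} {c} {δ} 0<b 0<c
          (x≤b m (ℕ.m⊔n≤o⇒m≤o B C BC≤m))
          (y≤c n (ℕ.m⊔n≤o⇒n≤o B C BC≤n))
          (xM m n (ℕ.m⊔n≤o⇒m≤o M N MN≤m) (ℕ.m⊔n≤o⇒m≤o M N MN≤n))
          (yN m n (ℕ.m⊔n≤o⇒n≤o M N MN≤m) (ℕ.m⊔n≤o⇒n≤o M N MN≤n))
        where
        BC≤m : B ℕ.⊔ C ℕ.≤ m
        BC≤m = ℕ.m⊔n≤o⇒m≤o (B ℕ.⊔ C) (M ℕ.⊔ N) K≤m
        BC≤n : B ℕ.⊔ C ℕ.≤ n
        BC≤n = ℕ.m⊔n≤o⇒m≤o (B ℕ.⊔ C) (M ℕ.⊔ N) K≤n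
        MN≤m : M ℕ.⊔ N ℕ.≤ m
        MN≤m = ℕ.m⊔n≤o⇒n≤o (B ℕ.⊔ C) (M ℕ.⊔ N) K≤m
        MN≤n : M ℕ.⊔ N ℕ.≤ n
        MN≤n = ℕ.m⊔n≤o⇒n≤o (B ℕ.⊔ C) (M ℕ.⊔ N) K≤n

_^ℝ_ : ℝ → ℕ → ℝ
x ^ℝ zero  = fromℚ 1ℚ
x ^ℝ suc n = x *ℝ (x ^ℝ n)

inverse : ∀ x → NonZeroℝ x → ℝ
inverse x (mkNonZeroℝ g 0<g K g≤∣x∣) = mkℝ (λ n → recip (seq x n)) cauchy
  where
  abstract
    cauchy : IsCauchy (λ n → recip (seq x n))
    cauchy ε 0<ε =
      let N , xN = isCauchy x (ε * (g * g)) (0<p*q 0<ε (0<p*q 0<g 0<g))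
      in K ℕ.⊔ N , λ m n K≤m K≤n →
        recip-error (seq x m) (seq x n) 0<g
          (g≤∣x∣ m (ℕ.m⊔n≤o⇒m≤o K N K≤m))
          (g≤∣x∣ n (ℕ.m⊔n≤o⇒m≤o K N K≤n))
          (xN n m (ℕ.m⊔n≤o⇒n≤o K N K≤n) (ℕ.m⊔n≤o⇒n≤o K N K≤m))

abstract
  inverseʳ : ∀ x (x≢0 : NonZeroℝ x) → x *ℝ inverse x x≢0 ≃ fromℚ 1ℚ
  inverseʳ x x≢0@(mkNonZeroℝ g 0<g K g≤∣x∣) = mk≃ λ ε 0<ε → K , λ n K≤n →
    ≤-<-trans (≤-reflexive (cong (λ p → ∣ p - 1ℚ ∣)
      (recip-inverse (0<g≤∣p∣⇒p≢0 0<g (g≤∣x∣ n K≤n))))) 0<ε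

infixl 7 _/ℝ_[_]

_/ℝ_[_] : ∀ (x y : ℝ) → NonZeroℝ y → ℝ
x /ℝ y [ y≢0 ] = x *ℝ inverse y y≢0

*-nonZero : ∀ {x y} → NonZeroℝ x → NonZeroℝ y → NonZeroℝ (x *ℝ y)
*-nonZero {x} {y} (mkNonZeroℝ g 0<g M g≤) (mkNonZeroℝ h 0<h N h≤) =
  mkNonZeroℝ (g * h) (0<p*q 0<g 0<h) (M ℕ.⊔ N) λ n K≤n → ≤-trans
    (*-mono-≤ (<⇒≤ 0<g) (0≤∣p∣ (seq y n)) (g≤ n (ℕ.m⊔n≤o⇒m≤o M N K≤n))
      (h≤ n (ℕ.m⊔n≤o⇒n≤o M N K≤n)))
    (≤-reflexive (sym (∣p*q∣≡∣p∣*∣q∣ (seq x n) (seq y n))))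

^-nonZero : ∀ {x} → NonZeroℝ x → ∀ n → NonZeroℝ (x ^ℝ n)
^-nonZero x≢0 zero    = mkNonZeroℝ 1ℚ 0<1 0 λ _ _ → ≤-refl
^-nonZero x≢0 (suc n) = *-nonZero x≢0 (^-nonZero x≢0 n)

-- The nonnegative square root of a rational a ≥ 0, by bisection:
-- (approx k)² ≤ a < (approx k + width k)² with width k = (1 + a) / 2ᵏ

module Sqrt (a : ℚ) (0≤a : 0ℚ ≤ a) where

  width : ℕ → ℚ
  width zero    = 1ℚ + a
  width (suc k) = ½ * width k

  step : ℚ → ℚ → ℚ
  step x w with (x + w) * (x + w) ≤? a
  ... | yes _ = x + w
  ... | no  _ = x

  approx : ℕ → ℚ
  approx zero    = 0ℚ
  approx (suc k) = step (approx k) (width (suc k))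

  upper : ℕ → ℚ
  upper k = approx k + width k

  step-elim : ∀ (P : ℚ → Set) x w →
    ((x + w) * (x + w) ≤ a → P (x + w)) → (a < (x + w) * (x + w) → P x) → P (step x w)
  step-elim P x w accept reject with (x + w) * (x + w) ≤? a
  ... | yes t²≤a = accept t²≤a
  ... | no  t²≰a = reject (≰⇒> t²≰a)

  abstract
    halves : ∀ w → ½ * w + ½ * w ≡ w
    halves w = trans (sym (*-distribʳ-+ w ½ ½)) (*-identityˡ w)

    0<width : ∀ k → 0ℚ < width k
    0<width zero    = <-≤-trans 0<1 (p≤p+q 0≤a)
    0<width (suc k) = 0<p*q 0<½ (0<width k)

    width-suc-≤ : ∀ k → width (suc k) ≤ width k
    width-suc-≤ k = ≤-trans (p≤p+q (<⇒≤ (0<width (suc k)))) (≤-reflexive (halves (width k)))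

    width-antimono : ∀ {m n} → m ℕ.≤ n → width n ≤ width m
    width-antimono m≤n = go (ℕ.≤⇒≤′ m≤n)
      where
      go : ∀ {m n} → m ℕ.≤′ n → width n ≤ width m
      go ℕ.≤′-refl               = ≤-refl
      go (ℕ.≤′-step {n = n} m≤n) = ≤-trans (width-suc-≤ n) (go m≤n)

    width-bound : ∀ k → width k * fromℕ (suc k) ≤ width 0
    width-bound zero    = ≤-reflexive (*-identityʳ (width 0))
    width-bound (suc k) = let open ≤-Reasoning ; w = width k ; f = fromℕ k in begin
      (½ * w) * (1ℚ + (1ℚ + f))          ≤⟨ p≤p+q (<⇒≤ 0<½ ⟨*⟩ (<⇒≤ (0<width k) ⟨*⟩ fromℕ-nonNeg k)) ⟩
      (½ * w) * (1ℚ + (1ℚ + f)) + ½ * (w * f)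
        ≡⟨ solve 3 (λ h w f → (h :* w) :* (con 1ℚ :+ (con 1ℚ :+ f)) :+ h :* (w :* f)
             := (h :+ h) :* (w :* (con 1ℚ :+ f))) refl ½ w f ⟩
      1ℚ * (w * (1ℚ + f))                ≡⟨ *-identityˡ _ ⟩
      w * (1ℚ + f)                       ≤⟨ width-bound k ⟩
      width 0                            ∎
      where
      _⟨*⟩_ : ∀ {p q} → 0ℚ ≤ p → 0ℚ ≤ q → 0ℚ ≤ p * q
      0≤p ⟨*⟩ 0≤q = *-mono-≤ ≤-refl 0≤q 0≤p 0≤q

    width-null : ∀ ε → 0ℚ < ε → ∃ λ N → ∀ n → N ℕ.≤ n → width n < ε
    width-null ε 0<ε =
      let b , _ , εb≡w = divide ε 0<ε (width 0) (0<width 0)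
          N , b≤N = archimedean b
      in N , λ n N≤n → ≤-<-trans (width-antimono N≤n)
        (*-cancelʳ-<-nonNeg (fromℕ (suc N)) {{ℚ.nonNegative (fromℕ-nonNeg (suc N))}}
          (≤-<-trans (width-bound N) (≤-<-trans (≤-reflexive (sym εb≡w))
            (*-monoʳ-<-pos ε {{positive 0<ε}} (≤-<-trans b≤N (n<1+n N))))))
      where
      n<1+n : ∀ n → fromℕ n < 1ℚ + fromℕ n
      n<1+n n = <-≤-trans (p<p+q 0<1) (≤-reflexive (+-comm (fromℕ n) 1ℚ))

    0≤approx : ∀ k → 0ℚ ≤ approx k
    0≤approx zero = ≤-refl
    0≤approx (suc k) = step-elim (0ℚ ≤_) (approx k) (width (suc k))
      (λ _ → ≤-trans (0≤approx k) (p≤p+q (<⇒≤ (0<width (suc k)))))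
      (λ _ → 0≤approx k)

    approx²≤a : ∀ k → approx k * approx k ≤ a
    approx²≤a zero = 0≤a
    approx²≤a (suc k) = step-elim (λ x → x * x ≤ a) (approx k) (width (suc k))
      (λ t²≤a → t²≤a)
      (λ _ → approx²≤a k)

    refine : ∀ x w → (x + ½ * w) + ½ * w ≡ x + w
    refine x w = trans (+-assoc x (½ * w) (½ * w)) (cong (λ h → x + h) (halves w))

    a<upper² : ∀ k → a < upper k * upper k
    a<upper² zero = let open ≤-Reasoning in begin-strict
      a                              <⟨ p<p+q 0<1 ⟩
      a + 1ℚ                         ≤⟨ p≤p+q (*-mono-≤ {0ℚ} {a} {0ℚ} {1ℚ + a} ≤-refl (<⇒≤ (0<width 0)) 0≤a (<⇒≤ (0<width 0))) ⟩
      (a + 1ℚ) + a * (1ℚ + a)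
        ≡⟨ solve 1 (λ a → (a :+ con 1ℚ) :+ a :* (con 1ℚ :+ a)
             := (con 0ℚ :+ (con 1ℚ :+ a)) :* (con 0ℚ :+ (con 1ℚ :+ a))) refl a ⟩
      upper 0 * upper 0              ∎
    a<upper² (suc k) = step-elim (λ x → a < (x + width (suc k)) * (x + width (suc k)))
      (approx k) (width (suc k))
      (λ _ → <-≤-trans (a<upper² k)
        (≤-reflexive (cong (λ p → p * p) (sym (refine (approx k) (width k))))))
      (λ a<t² → a<t²)

    upper-antimono : ∀ n → upper n ≤ upper 0
    upper-antimono zero    = ≤-refl
    upper-antimono (suc k) = step-elim (λ x → x + width (suc k) ≤ upper 0)
      (approx k) (width (suc k))
      (λ _ → ≤-trans (≤-reflexive (refine (approx k) (width k))) (upper-antimono k))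
      (λ _ → ≤-trans (+-monoʳ-≤ (approx k) (width-suc-≤ k)) (upper-antimono k))

    approx<upper : ∀ m n → approx m < upper n
    approx<upper m n = ≰⇒> λ u≤x → <-irrefl refl (<-≤-trans (a<upper² n) (≤-trans
      (*-mono-≤ 0≤u (0≤approx m) u≤x u≤x) (approx²≤a m)))
      where
      0≤u : 0ℚ ≤ upper n
      0≤u = ≤-trans (0≤approx n) (p≤p+q (<⇒≤ (0<width n)))

    approx-cauchy : IsCauchy approx
    approx-cauchy ε 0<ε = let N , wN = width-null ε 0<ε in
      N , λ m n N≤m N≤n → ∣p∣<q
        (<-trans (p<q+r⇒p-q<r (approx<upper m n)) (wN n N≤n))
        (≤-<-trans (≤-reflexive (-[p-q]≡q-p (approx m) (approx n)))
          (<-trans (p<q+r⇒p-q<r (approx<upper n m)) (wN m N≤m)))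

    square-error : ∀ n {δ} → width n < δ →
      ∣ approx n * approx n - a ∣ < (upper 0 + upper 0) * δ
    square-error n {δ} w<δ = ∣p∣<q
      (p<q+r⇒p-q<r (≤-<-trans (approx²≤a n) (p<p+q (0<p*q 0<b 0<δ))))
      (begin-strict
        - (x * x - a)      ≡⟨ -[p-q]≡q-p (x * x) a ⟩
        a - x * x          <⟨ +-monoˡ-< (- (x * x)) (a<upper² n) ⟩
        (x + w) * (x + w) - x * x
          ≡⟨ solve 2 (λ x w → (x :+ w) :* (x :+ w) :- x :* x := (x :+ (x :+ w)) :* w) refl x w ⟩
        (x + (x + w)) * w
          ≤⟨ *-monoʳ-≤-nonNeg w {{ℚ.nonNegative (<⇒≤ (0<width n))}}
               (+-mono-≤ (<⇒≤ (approx<upper n 0)) (upper-antimono n)) ⟩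
        b * w              <⟨ *-monoʳ-<-pos b {{positive 0<b}} w<δ ⟩
        b * δ              ∎)
      where
      open ≤-Reasoning
      x w b : ℚ
      x = approx n
      w = width n
      b = upper 0 + upper 0
      0<b : 0ℚ < b
      0<b = <-trans (approx<upper 0 0) (p<p+q (approx<upper 0 0))
      0<δ : 0ℚ < δ
      0<δ = <-trans (0<width n) w<δ

√ : ∀ a → 0ℚ ≤ a → ℝ
√ a 0≤a = mkℝ (Sqrt.approx a 0≤a) (Sqrt.approx-cauchy a 0≤a)

abstract
  √-square : ∀ a 0≤a → √ a 0≤a *ℝ √ a 0≤a ≃ fromℚ a
  √-square a 0≤a = mk≃ λ ε 0<ε →
    let δ , 0<δ , bδ≡ε = divide (upper 0 + upper 0)
          (<-trans (approx<upper 0 0) (p<p+q (approx<upper 0 0))) ε 0<ε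
        N , wN = width-null δ 0<δ
    in N , λ n N≤n → <-≤-trans (square-error n (wN n N≤n)) (≤-reflexive bδ≡ε)
    where open Sqrt a 0≤a

5ℚ : ℚ
5ℚ = + 5 ℚ./ 1

0≤5 : 0ℚ ≤ 5ℚ
0≤5 = toWitness {a? = 0ℚ ≤? 5ℚ} _

√5 : ℝ
√5 = √ 5ℚ 0≤5

1ℝ 2ℝ : ℝ
1ℝ = fromℚ 1ℚ
2ℝ = fromℚ (+ 2 ℚ./ 1)

2ℝ≢0 : NonZeroℝ 2ℝ
2ℝ≢0 = mkNonZeroℝ 1ℚ 0<1 0 λ _ _ → toWitness {a? = 1ℚ ≤? (+ 2 ℚ./ 1)} _

φ : ℝ
φ = (1ℝ +ℝ √5) /ℝ 2ℝ [ 2ℝ≢0 ]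

φ≢0 : NonZeroℝ φ
φ≢0 = *-nonZero {1ℝ +ℝ √5} {inverse 2ℝ 2ℝ≢0}
  (mkNonZeroℝ 1ℚ 0<1 0 λ n _ → 1≤∣1+s∣ (seq √5 n) (Sqrt.0≤approx 5ℚ 0≤5 n))
  (mkNonZeroℝ ½ 0<½ 0 λ _ _ → ≤-refl)
  where
  1≤∣1+s∣ : ∀ s → 0ℚ ≤ s → 1ℚ ≤ ∣ 1ℚ + s ∣
  1≤∣1+s∣ s 0≤s = ≤-trans (p≤p+q 0≤s)
    (≤-reflexive (sym (0≤p⇒∣p∣≡p (≤-trans (<⇒≤ 0<1) (p≤p+q 0≤s)))))

-- Segments are numbered from 1; the value at 0, where the exponent n ∸ 1 is
-- truncated to 0, has no meaning.
segmentLength : ℕ → ℝ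
segmentLength n = 1ℝ /ℝ φ ^ℝ (n ℕ.∸ 1) [ ^-nonZero φ≢0 (n ℕ.∸ 1) ]

{-# OPTIONS --safe #-}
-- With w the n-th approximant of 1/φᵏ⁺² and s that of √5, the n-th approximants
-- of 1/φᵏ and 1/φᵏ⁺¹ are φ²w and φw, so the error of the claimed equation is
-- w (1 + φ - φ²) = -¼ w (s² - 5): a bounded sequence times a null one.
module Submission where

open import Defs
open import Data.Nat.Base using (ℕ; _>_; _∸_)
open import Data.Integer.Base using (-[1+_])
open import Data.Nat.Base as ℕ using (suc; s≤s)
import Data.Nat.Properties as ℕ
open import Data.Product.Base using (∃; _,_)
open import Data.Rational.Base as ℚ
  using (ℚ; 0ℚ; 1ℚ; ½; _+_; _-_; _*_; ∣_∣; positive)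
open import Data.Rational.Properties
open import Data.Rational.Solver using (module +-*-Solver)
open import Relation.Binary.PropositionalEquality
  using (_≡_; _≢_; refl; trans; cong; cong₂)

open +-*-Solver using (solve; _:=_; _:+_; _:*_; _:-_; con)

p*q≢0⇒q≢0 : ∀ p {q} → p * q ≢ 0ℚ → q ≢ 0ℚ
p*q≢0⇒q≢0 p pq≢0 refl = pq≢0 (*-zeroʳ p)

-- Rewrites reciprocals of lower powers as multiples of the reciprocal of the highest one. The
-- hypothesis keeps both arguments of `recip` away from its default value at 0.
recip-cancelˡ : ∀ p q → p * q ≢ 0ℚ → recip q ≡ p * recip (p * q)
recip-cancelˡ p q pq≢0 =
  go (recip q) (recip (p * q)) (recip-inverse (p*q≢0⇒q≢0 p pq≢0)) (recip-inverse pq≢0)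
  where
  open ≤-Reasoning
  go : ∀ c d → q * c ≡ 1ℚ → (p * q) * d ≡ 1ℚ → c ≡ p * d
  go c d qc≡1 pqd≡1 = begin-equality
    c                  ≡⟨ *-identityʳ c ⟨
    c * 1ℚ             ≡⟨ cong (c *_) pqd≡1 ⟨
    c * ((p * q) * d)
      ≡⟨ solve 4 (λ p q c d → c :* ((p :* q) :* d) := (q :* c) :* (p :* d)) refl p q c d ⟩
    (q * c) * (p * d)  ≡⟨ cong (_* (p * d)) qc≡1 ⟩
    1ℚ * (p * d)       ≡⟨ *-identityˡ (p * d) ⟩
    p * d              ∎

eventually≢0 : ∀ {x} (x≢0 : NonZeroℝ x) n → NonZeroℝ.from x≢0 ℕ.≤ n → seq x n ≢ 0ℚ
eventually≢0 (mkNonZeroℝ _ 0<g _ g≤∣x∣) n K≤n = 0<g≤∣p∣⇒p≢0 0<g (g≤∣x∣ n K≤n)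

-- A Cauchy sequence is eventually bounded, so `z` times a null sequence is null. The factorisation
-- is asked for only from some index on, because approximants of a nonzero real may vanish before
-- its gap takes effect.
≃-multiple : ∀ {x y a b} z → a ≃ b →
  (∃ λ K → ∀ n → K ℕ.≤ n → seq x n - seq y n ≡ seq z n * (seq a n - seq b n)) → x ≃ y
≃-multiple {x} {y} {a} {b} z (mk≃ a→b) (K , factor) = mk≃ λ ε 0<ε →
  let c , 0<c , M , z≤c = eventuallyBounded z
      δ , 0<δ , cδ≡ε    = divide c 0<c ε 0<ε
      N , ab<δ          = a→b δ 0<δ
  in K ℕ.⊔ (M ℕ.⊔ N) , λ n L≤n →
    let K≤n  = ℕ.m⊔n≤o⇒m≤o K (M ℕ.⊔ N) L≤n
        MN≤n = ℕ.m⊔n≤o⇒n≤o K (M ℕ.⊔ N) L≤n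
        M≤n  = ℕ.m⊔n≤o⇒m≤o M N MN≤n
        N≤n  = ℕ.m⊔n≤o⇒n≤o M N MN≤n
        d    = seq a n - seq b n
        open ≤-Reasoning
    in begin-strict
      ∣ seq x n - seq y n ∣  ≡⟨ cong ∣_∣ (factor n K≤n) ⟩
      ∣ seq z n * d ∣        ≡⟨ ∣p*q∣≡∣p∣*∣q∣ (seq z n) d ⟩
      ∣ seq z n ∣ * ∣ d ∣
        ≤⟨ *-mono-≤ (0≤∣p∣ (seq z n)) (0≤∣p∣ d) (z≤c n M≤n) ≤-refl ⟩
      c * ∣ d ∣              <⟨ *-monoʳ-<-pos c {{positive 0<c}} (ab<δ n N≤n) ⟩
      c * δ                  ≡⟨ cδ≡ε ⟩
      ε                      ∎

-¼ : ℚ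
-¼ = -[1+ 0 ] ℚ./ 4

-- Here `s`, `f` and `p` stand for approximants of √5, φ and φᵏ; the factors `1ℚ` are the numerators
-- in `segmentLength`.
golden-error : ∀ s p → let f = (1ℚ + s) * ½ ; w = recip (f * (f * p)) in
  f * (f * p) ≢ 0ℚ →
  1ℚ * w - (1ℚ * recip p - 1ℚ * recip (f * p)) ≡ (w * -¼) * (s * s - 5ℚ)
golden-error s p ffp≢0 = trans
  (cong₂ (λ u v → 1ℚ * w - (1ℚ * u - 1ℚ * v)) u≡ffw v≡fw)
  -- With `p` eliminated, a polynomial identity in `s` and `w` remains.
  (solve 2 (λ s w → let f = (con 1ℚ :+ s) :* con ½ in
      con 1ℚ :* w :- (con 1ℚ :* (f :* (f :* w)) :- con 1ℚ :* (f :* w))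
        := (w :* con -¼) :* (s :* s :- con 5ℚ))
    refl s w)
  where
  f w : ℚ
  f = (1ℚ + s) * ½
  w = recip (f * (f * p))
  v≡fw : recip (f * p) ≡ f * w
  v≡fw = recip-cancelˡ f (f * p) ffp≢0
  u≡ffw : recip p ≡ f * (f * w)
  u≡ffw = trans (recip-cancelˡ f p (p*q≢0⇒q≢0 f ffp≢0)) (cong (f *_) v≡fw)

corollary5p2 : ∀ (n : ℕ) → n > 2 →
    segmentLength n ≃ segmentLength (n ∸ 2) -ℝ segmentLength (n ∸ 1)
-- With n = k + 3 the three exponents are k + 2, k and k + 1, so no subtraction is truncated.
corollary5p2 (suc (suc (suc k))) (s≤s (s≤s (s≤s _))) =
  ≃-multiple (inverse (φ ^ℝ suc (suc k)) φᵏ⁺²≢0 *ℝ fromℚ -¼) (√-square 5ℚ 0≤5)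
    -- Real operations act termwise, so `golden-error` applies at each index past the one where φᵏ⁺²
    -- is bounded away from 0.
    (NonZeroℝ.from φᵏ⁺²≢0 , λ n K≤n →
      golden-error (seq √5 n) (seq (φ ^ℝ k) n) (eventually≢0 φᵏ⁺²≢0 n K≤n))
  where
  φᵏ⁺²≢0 : NonZeroℝ (φ ^ℝ suc (suc k))
  φᵏ⁺²≢0 = ^-nonZero φ≢0 (suc (suc k))
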